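{- There is no universal constant $c>0$ such that the LP-based independent rounding algorithm satisfies $\mathbb E[\mathrm{Rev}^{\mathrm{LP}}]\ge c\,\mathrm{OPT}_{\mathrm{on}}$ for all instances of the online allocation model in the full-compatibility setting.
   Context: Model. An instance consists of products $\mathcal I=\{1,\dots,m\}$, capacities $b_i\in\mathbb Z_+$, base rewards $r_i\ge 0$, bonus functions $f_i:\mathbb Z_+\to\mathbb R_+$ that are nonnegative and nondecreasing with $f_i(0)=0$, a horizon of $T$ periods and arrival probabilities $p_1,\dots,p_T\in[0,1]$. In period $t$ a customer arrives with probability $p_t$, independently across periods; $L$ is the total number of arrivals and $\mu_L=\sum_{t=1}^T p_t$ its mean. Each arriving customer must be immediately and irrevocably assigned to a product with remaining capacity or rejected; every customer may be assigned to every product (full compatibility). The $k$-th sale of product $i$ yields reward $r_i+f_i(k)$. An online algorithm $\pi$ knows all parameters of the instance, but its decision in each period depends only on the arrivals observed so far, its past decisions and internal randomization independent of the arrivals. $\mathrm{Rev}^\pi$ is its random total reward and $\mathrm{OPT}_{\mathrm{on}}=\sup_\pi\mathbb E[\mathrm{Rev}^\pi]$ over all online algorithms. LP relaxation: maximize $\sum_{i\in\mathcal I}\sum_{k=1}^{b_i}(r_i+f_i(k))\,y_{i,k}$ subject to $\sum_{i\in\mathcal I}\sum_{k=1}^{b_i}y_{i,k}\le\mu_L$; $y_{i,k}\le y_{i,k-1}$ for all $i\in\mathcal I$, $k=2,\dots,b_i$; $0\le y_{i,k}\le1$ for all $i\in\mathcal I$, $k=1,\dots,b_i$. LP-based independent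 rounding: given an optimal solution $\boldsymbol y^*$ of this LP, set $q_i=\frac1{\mu_L}\sum_{k=1}^{b_i}y^*_{i,k}$. Each arriving customer is independently assigned to product $i$ with probability $q_i$, with any remaining probability assigned to rejection; a customer directed to a product with no remaining capacity is rejected. -}

module Defs where

open import Level using (Level; _⊔_) renaming (suc to lsuc)
open import Algebra.Bundles using (CommutativeRing)
open import Algebra.Definitions using (Invertible)
open import Data.Bool.Base using (if_then_else_)
open import Data.Fin.Base using (Fin; zero; suc; toℕ)
import Data.Fin.Properties as Fin
open import Data.List.Base using (List; []; _∷_; map; concatMap; foldr; tabulate)
open import Data.List.Relation.Unary.All using (All)
open import Data.Nat.Base as ℕ using (ℕ; zero; suc)
import Data.Nat.Properties as ℕ
open import Data.Product.Base using (∃-syntax; _×_; _,_; proj₁; proj₂; map₂)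
open import Data.Unit.Base using (⊤)
open import Relation.Binary.Core using (Rel)
open import Relation.Binary.PropositionalEquality.Core using (_≡_)
open import Relation.Binary.Structures using (IsTotalOrder)
import Relation.Binary.Construct.NonStrictToStrict as ToStrict
open import Relation.Nullary.Decidable.Core using (does)

-- The library has no real numbers, so all real quantities live in an arbitrary
-- ordered field; ℝ and ℚ are instances.
record OrderedField (c ℓ₁ ℓ₂ : Level) : Set (lsuc (c ⊔ ℓ₁ ⊔ ℓ₂)) where
  infix 4 _≤_
  field
    commutativeRing : CommutativeRing c ℓ₁

  open CommutativeRing commutativeRing public

  field
    _≤_          : Rel Carrier ℓ₂
    isTotalOrder : IsTotalOrder _≈_ _≤_
    +-monoʳ-≤    : ∀ x {y z} → y ≤ z → x + y ≤ x + z
    *-nonneg     : ∀ {x y} → 0# ≤ x → 0# ≤ y → 0# ≤ x * y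
    0≉1          : 0# ≉ 1#
    ≉0⇒invertible : ∀ {x} → x ≉ 0# → Invertible _≈_ 1# _*_ x

  open ToStrict _≈_ _≤_ public using (_<_)

  inverse : ∀ x → x ≉ 0# → Carrier
  inverse x x≉0 = proj₁ (≉0⇒invertible x≉0)

-- What happens to an arriving customer, with m products on offer.
data Decision (m : ℕ) : Set where
  assign : Fin m → Decision m
  reject : Decision m

data Event (m : ℕ) : Set where
  noArrival : Event m
  arrival   : Decision m → Event m

-- Most recent period first.
History : ℕ → Set
History m = List (Event m)

sold : ∀ {m} → Fin m → History m → ℕ
sold i []                         = 0
sold i (noArrival ∷ h)            = sold i h
sold i (arrival reject ∷ h)       = sold i h
sold i (arrival (assign j) ∷ h)   =
  if does (i Fin.≟ j) then suc (sold i h) else sold i h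

module Allocation {c ℓ₁ ℓ₂} (F : OrderedField c ℓ₁ ℓ₂) where
  open OrderedField F hiding (zero)
  open import Algebra.Properties.Semiring.Sum semiring using (sum; sum-syntax)

  -- Finitely supported weighted lists; repeated outcomes add up.
  Weighted : ∀ {a} → Set a → Set (c ⊔ a)
  Weighted A = List (Carrier × A)

  𝔼 : ∀ {a} {A : Set a} → Weighted A → (A → Carrier) → Carrier
  𝔼 D X = foldr (λ (w , x) s → w * X x + s) 0# D

  IsDistribution : ∀ {a} {A : Set a} → Weighted A → Set (c ⊔ ℓ₁ ⊔ ℓ₂ ⊔ a)
  IsDistribution D = All (λ (w , _) → 0# ≤ w) D × 𝔼 D (λ _ → 1#) ≈ 1#

  _>>=_ : ∀ {a b} {A : Set a} {B : Set b} →
          Weighted A → (A → Weighted B) → Weighted B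
  D >>= K = concatMap (λ (w , x) → map (λ (v , y) → w * v , y) (K x)) D

  record Instance : Set (c ⊔ ℓ₁ ⊔ ℓ₂) where
    field
      m        : ℕ
      b        : Fin m → ℕ
      r        : Fin m → Carrier
      r-nonneg : ∀ i → 0# ≤ r i
      f        : Fin m → ℕ → Carrier
      f-nonneg : ∀ i k → 0# ≤ f i k
      f-mono   : ∀ i {j k} → j ℕ.≤ k → f i j ≤ f i k
      f-zero   : ∀ i → f i 0 ≈ 0#
      T        : ℕ
      p        : Fin T → Carrier
      p-nonneg : ∀ t → 0# ≤ p t
      p≤1      : ∀ t → p t ≤ 1#

    -- Reward of the k-th sale of product i, for k ≥ 1.
    reward : Fin m → ℕ → Carrier
    reward i k = r i + f i k

    μL : Carrier
    μL = sum p

  module _ (I : Instance) where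
    open Instance I

    -- The distribution of the decision for a customer arriving after the given
    -- history, which records earlier arrivals and decisions. Randomization is
    -- internal: it is independent of the arrivals.
    DecisionRule : Set c
    DecisionRule = History m → Weighted (Decision m)

    Admissible : History m → Decision m → Set
    Admissible h (assign i) = sold i h ℕ.< b i
    Admissible h reject     = ⊤

    record OnlineAlgorithm : Set (c ⊔ ℓ₁ ⊔ ℓ₂) where
      field
        rule         : DecisionRule
        distribution : ∀ h → IsDistribution (rule h)
        admissible   : ∀ h → All (λ (_ , d) → Admissible h d) (rule h)

    period : DecisionRule → Carrier → History m → Weighted (History m)
    period π pₜ h =
      (1# - pₜ , noArrival ∷ h) ∷ map (λ (w , d) → pₜ * w , arrival d ∷ h) (π h)

    run : DecisionRule → ∀ {n} → (Fin n → Carrier) → History m → Weighted (History m)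
    run π {zero}  ps h = (1# , h) ∷ []
    run π {suc n} ps h = period π (ps zero) h >>= run π (λ t → ps (suc t))

    Rev : History m → Carrier
    Rev h = ∑[ i < m ] ∑[ k < sold i h ] reward i (suc (toℕ k))

    𝔼Rev : DecisionRule → Carrier
    𝔼Rev π = 𝔼 (run π p []) Rev

    -- v is the supremum of the expected rewards of all online algorithms.
    IsOPTon : Carrier → Set (c ⊔ ℓ₁ ⊔ ℓ₂)
    IsOPTon v =
      (∀ (π : OnlineAlgorithm) → 𝔼Rev (OnlineAlgorithm.rule π) ≤ v) ×
      (∀ u → (∀ (π : OnlineAlgorithm) → 𝔼Rev (OnlineAlgorithm.rule π) ≤ u) → v ≤ u)

    -- The index k : Fin (b i) stands for the sale numbered suc (toℕ k).
    LPVector : Set c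
    LPVector = (i : Fin m) → Fin (b i) → Carrier

    record IsFeasible (y : LPVector) : Set (c ⊔ ℓ₁ ⊔ ℓ₂) where
      field
        budget     : ∑[ i < m ] ∑[ k < b i ] y i k ≤ μL
        decreasing : ∀ i (j k : Fin (b i)) → toℕ k ≡ suc (toℕ j) → y i k ≤ y i j
        nonneg     : ∀ i k → 0# ≤ y i k
        ≤1         : ∀ i k → y i k ≤ 1#

    objective : LPVector → Carrier
    objective y = ∑[ i < m ] ∑[ k < b i ] (reward i (suc (toℕ k)) * y i k)

    IsOptimal : LPVector → Set (c ⊔ ℓ₁ ⊔ ℓ₂)
    IsOptimal y = IsFeasible y × (∀ z → IsFeasible z → objective z ≤ objective y)

    direct : (Fin m → Carrier) → Weighted (Decision m)
    direct q = (1# - sum q , reject) ∷ tabulate (λ i → q i , assign i)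

    screen : History m → Decision m → Decision m
    screen h (assign i) = if does (sold i h ℕ.<? b i) then assign i else reject
    screen h reject     = reject

    rounding : μL ≉ 0# → LPVector → DecisionRule
    rounding μL≉0 y h = map (map₂ (screen h)) (direct q)
      where
      q : Fin m → Carrier
      q i = inverse μL μL≉0 * ∑[ k < b i ] y i k

  -- Ties between optimal LP solutions are broken in favour of the algorithm, so
  -- refuting this guarantee refutes it for every tie-breaking rule. The premise
  -- that an optimal solution exists prevents the refutation from resting on an
  -- unsolvable LP. If μL ≈ 0, the probabilities q are undefined and no customer
  -- ever arrives.
  HasGuarantee : Carrier → Set (c ⊔ ℓ₁ ⊔ ℓ₂)
  HasGuarantee α =
    ∀ (I : Instance) (μL≉0 : Instance.μL I ≉ 0#) →
    (∃[ y ] IsOptimal I y) →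
    ∃[ y* ] (IsOptimal I y* ×
             (∀ OPT → IsOPTon I OPT → α * OPT ≤ 𝔼Rev I (rounding I μL≉0 y*)))

{-# OPTIONS --safe #-}

-- One customer arrives with certainty. Product 0 pays 4 for its second sale and
-- nothing for its first; product 1 has capacity 1 and pays 1. Selling half a
-- pair of product 0 is worth 2 to the LP, so every optimal solution sends the
-- customer to product 0, where a single sale earns nothing, whereas an online
-- algorithm earns 1 with product 1.

module Submission where

open import Defs
open import Data.Fin.Base using (Fin; zero; suc)
open import Data.List.Base using ([]; _∷_; map)
open import Data.List.Relation.Unary.All using (All; []; _∷_)
open import Data.Nat.Base as ℕ using (ℕ; suc; s≤s; z≤n)
open import Data.Product.Base using (∃-syntax; _×_; _,_; proj₁; proj₂)
open import Data.Sum.Base using (inj₁; inj₂)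
open import Data.Unit.Base using (tt)
import Relation.Binary.Reasoning.PartialOrder as ≤-Reasoning
import Relation.Binary.Reasoning.Setoid as ≈-Reasoning
open import Relation.Binary.Bundles using (Poset)
import Relation.Binary.PropositionalEquality.Core as ≡
open import Relation.Binary.Structures using (IsTotalOrder)
open import Relation.Nullary.Negation.Core using (¬_)

-- Arithmetic of inequalities in an ordered field.

module OrderedFieldProperties {c ℓ₁ ℓ₂} (F : OrderedField c ℓ₁ ℓ₂) where
  open OrderedField F hiding (zero)
  open IsTotalOrder isTotalOrder public
    using (isPartialOrder; total; antisym; ≤-respˡ-≈; ≤-respʳ-≈)
    renaming (reflexive to ≤-reflexive; refl to ≤-refl; trans to ≤-trans)
  open import Algebra.Properties.Ring ring using (-1*x≈-x; -‿involutive)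

  poset : Poset c ℓ₁ ℓ₂
  poset = record { isPartialOrder = isPartialOrder }

  open ≤-Reasoning poset

  +-monoˡ-≤ : ∀ x {y z} → y ≤ z → y + x ≤ z + x
  +-monoˡ-≤ x {y} {z} y≤z = begin
    y + x  ≈⟨ +-comm y x ⟩
    x + y  ≤⟨ +-monoʳ-≤ x y≤z ⟩
    x + z  ≈⟨ +-comm x z ⟩
    z + x  ∎

  +-mono-≤ : ∀ {w x y z} → w ≤ x → y ≤ z → w + y ≤ x + z
  +-mono-≤ {x = x} {y} w≤x y≤z = ≤-trans (+-monoˡ-≤ y w≤x) (+-monoʳ-≤ x y≤z)

  x≤y⇒0≤y-x : ∀ {x y} → x ≤ y → 0# ≤ y - x
  x≤y⇒0≤y-x {x} {y} x≤y = begin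
    0#     ≈⟨ -‿inverseʳ x ⟨
    x - x  ≤⟨ +-monoˡ-≤ (- x) x≤y ⟩
    y - x  ∎

  -- The gap `x * (z - y)` is a product of nonnegative factors, and adding it to `x * y` gives
  -- `x * z`.
  *-monoˡ-≤-nonneg : ∀ {x y z} → 0# ≤ x → y ≤ z → x * y ≤ x * z
  *-monoˡ-≤-nonneg {x} {y} {z} 0≤x y≤z = begin
    x * y                ≈⟨ +-identityʳ (x * y) ⟨
    x * y + 0#           ≤⟨ +-monoʳ-≤ (x * y) (*-nonneg 0≤x (x≤y⇒0≤y-x y≤z)) ⟩
    x * y + x * (z - y)  ≈⟨ distribˡ x y (z - y) ⟨
    x * (y + (z - y))    ≈⟨ *-congˡ (+-congˡ (+-comm z (- y))) ⟩
    x * (y + (- y + z))  ≈⟨ *-congˡ (+-assoc y (- y) z) ⟨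
    x * ((y - y) + z)    ≈⟨ *-congˡ (+-congʳ (-‿inverseʳ y)) ⟩
    x * (0# + z)         ≈⟨ *-congˡ (+-identityˡ z) ⟩
    x * z                ∎

  +-cancelˡ-≤ : ∀ x {y z} → x + y ≤ x + z → y ≤ z
  +-cancelˡ-≤ x {y} {z} x+y≤x+z = begin
    y              ≈⟨ -x+[x+w]≈w y ⟨
    - x + (x + y)  ≤⟨ +-monoʳ-≤ (- x) x+y≤x+z ⟩
    - x + (x + z)  ≈⟨ -x+[x+w]≈w z ⟩
    z              ∎
    where
    -x+[x+w]≈w : ∀ w → - x + (x + w) ≈ w
    -x+[x+w]≈w w = trans (sym (+-assoc (- x) x w))
                         (trans (+-congʳ (-‿inverseˡ x)) (+-identityˡ w))

  -- If `1# ≤ 0#`, then `- 1#` is nonnegative, and so is its square `1#`.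
  0≤1 : 0# ≤ 1#
  0≤1 with total 0# 1#
  ... | inj₁ 0≤1 = 0≤1
  ... | inj₂ 1≤0 = begin
    0#           ≤⟨ *-nonneg 0≤-1 0≤-1 ⟩
    - 1# * - 1#  ≈⟨ -1*x≈-x (- 1#) ⟩
    - - 1#       ≈⟨ -‿involutive 1# ⟩
    1#           ∎
    where
    0≤-1 : 0# ≤ - 1#
    0≤-1 = ≤-respʳ-≈ (+-identityˡ (- 1#)) (x≤y⇒0≤y-x 1≤0)

  1≤1+1 : 1# ≤ 1# + 1#
  1≤1+1 = ≤-respˡ-≈ (+-identityʳ 1#) (+-monoʳ-≤ 1# 0≤1)

  0≤1+1 : 0# ≤ 1# + 1#
  0≤1+1 = ≤-trans 0≤1 1≤1+1

  -- Otherwise `1# ≤ 0#`. This makes `½` available in every ordered field.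
  1+1≉0 : 1# + 1# ≉ 0#
  1+1≉0 1+1≈0 = 0≉1 (antisym 0≤1 (≤-respʳ-≈ 1+1≈0 1≤1+1))

-- Expectations over weighted lists and runs of one period.

module Expectation {c ℓ₁ ℓ₂} (F : OrderedField c ℓ₁ ℓ₂) where
  open OrderedField F hiding (zero)
  open OrderedFieldProperties F
  open Allocation F

  𝔼-mono-≤ : ∀ {a} {A : Set a} {D : Weighted A} {X Y : A → Carrier} →
             All (λ (w , _) → 0# ≤ w) D → (∀ x → X x ≤ Y x) → 𝔼 D X ≤ 𝔼 D Y
  𝔼-mono-≤ []          X≤Y = ≤-refl
  𝔼-mono-≤ (0≤w ∷ 0≤D) X≤Y =
    +-mono-≤ (*-monoˡ-≤-nonneg 0≤w (X≤Y _)) (𝔼-mono-≤ 0≤D X≤Y)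

  -- The bind is what the arrival branches of a last period unfold to: `v` is the arrival
  -- probability, and the point mass is the run over the zero periods that remain.
  𝔼-rescale->>=-point : ∀ {a b} {A : Set a} {B : Set b} (v : Carrier) (g : A → B)
                        (D : Weighted A) (X : B → Carrier) →
                        v ≈ 1# →
                        𝔼 (map (λ (w , x) → v * w , g x) D >>= λ y → (1# , y) ∷ []) X
                          ≈ 𝔼 D (λ x → X (g x))
  𝔼-rescale->>=-point v g []            X v≈1 = refl
  𝔼-rescale->>=-point v g ((w , x) ∷ D) X v≈1 =
    +-cong (*-congʳ (trans (*-identityʳ (v * w)) (trans (*-congʳ v≈1) (*-identityˡ w))))
           (𝔼-rescale->>=-point v g D X v≈1)

  module _ (I : Instance) where
    -- The branch without arrival has weight `1# - p₀`, which is zero, so only the decision is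
    -- random.
    𝔼-run-sure : ∀ (π : DecisionRule I) (ps : Fin 1 → Carrier) → ps zero ≈ 1# →
                 ∀ h X → 𝔼 (run I π ps h) X ≈ 𝔼 (π h) (λ d → X (arrival d ∷ h))
    𝔼-run-sure π ps p≈1 h X = begin
      (1# - p₀) * 1# * X (noArrival ∷ h) + rest  ≈⟨ +-congʳ (*-congʳ (*-congʳ 1-p≈0)) ⟩
      0# * 1# * X (noArrival ∷ h) + rest         ≈⟨ +-congʳ (trans (*-congʳ (zeroˡ 1#)) (zeroˡ _)) ⟩
      0# + rest                                  ≈⟨ +-identityˡ rest ⟩
      rest                                       ≈⟨ 𝔼-rescale->>=-point p₀ (λ d → arrival d ∷ h) (π h) X p≈1 ⟩
      𝔼 (π h) (λ d → X (arrival d ∷ h))          ∎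
      where
      open ≈-Reasoning setoid
      p₀ = ps zero
      rest = 𝔼 (map (λ (w , d) → p₀ * w , arrival d ∷ h) (π h) >>= λ h′ → (1# , h′) ∷ []) X
      1-p≈0 : 1# - p₀ ≈ 0#
      1-p≈0 = trans (+-congˡ (-‿cong p≈1)) (-‿inverseʳ 1#)

module Counterexample {c ℓ₁ ℓ₂} (F : OrderedField c ℓ₁ ℓ₂) where
  open OrderedField F hiding (zero)
  open OrderedFieldProperties F
  open Allocation F
  open Expectation F
  open import Algebra.Solver.Ring.NaturalCoefficients.Default commutativeSemiring
  open ≤-Reasoning poset

  -- The instance.

  2# 4# : Carrier
  2# = 1# + 1#
  4# = 2# * 2#

  0≤4 : 0# ≤ 4#
  0≤4 = *-nonneg 0≤1+1 0≤1+1

  -- Two sales average 2 per unit of LP budget, strictly above the 1 of product 1. The bonus stays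
  -- at `4#` past the capacity because monotonicity is required on all of ℕ.
  pairBonus : ℕ → Carrier
  pairBonus 0             = 0#
  pairBonus 1             = 0#
  pairBonus (suc (suc _)) = 4#

  pairBonus-nonneg : ∀ k → 0# ≤ pairBonus k
  pairBonus-nonneg 0             = ≤-refl
  pairBonus-nonneg 1             = ≤-refl
  pairBonus-nonneg (suc (suc _)) = 0≤4

  pairBonus-mono : ∀ {j k} → j ℕ.≤ k → pairBonus j ≤ pairBonus k
  pairBonus-mono {k = k} z≤n             = pairBonus-nonneg k
  pairBonus-mono {k = k} (s≤s z≤n)       = pairBonus-nonneg k
  pairBonus-mono         (s≤s (s≤s j≤k)) = ≤-refl

  pairVersusSingle : Instance
  pairVersusSingle = record
    { m        = 2
    ; b        = λ { zero → 2 ; (suc zero) → 1 }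
    ; r        = λ { zero → 0# ; (suc zero) → 1# }
    ; r-nonneg = λ { zero → ≤-refl ; (suc zero) → 0≤1 }
    ; f        = λ { zero → pairBonus ; (suc zero) _ → 0# }
    ; f-nonneg = λ { zero → pairBonus-nonneg ; (suc zero) _ → ≤-refl }
    ; f-mono   = λ { zero → pairBonus-mono ; (suc zero) _ → ≤-refl }
    ; f-zero   = λ { zero → refl ; (suc zero) → refl }
    ; T        = 1
    ; p        = λ _ → 1#
    ; p-nonneg = λ _ → 0≤1
    ; p≤1      = λ _ → ≤-refl
    }

  open Instance pairVersusSingle using (μL; p)

  μL≉0 : μL ≉ 0#
  μL≉0 μL≈0 = 0≉1 (trans (sym μL≈0) (+-identityʳ 1#))

  -- Revenue of one decision and the online optimum.

  revenue : Decision 2 → Carrier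
  revenue d = Rev pairVersusSingle (arrival d ∷ [])

  revenue-reject : revenue reject ≈ 0#
  revenue-reject = solve 0 (con 0 :+ (con 0 :+ con 0) := con 0) refl

  -- Only the first sale of the pair is made, and `pairBonus 1` is zero.
  revenue-pair : revenue (assign zero) ≈ 0#
  revenue-pair =
    solve 0 ((con 0 :+ con 0) :+ con 0 :+ (con 0 :+ con 0) := con 0) refl

  revenue-single : revenue (assign (suc zero)) ≈ 1#
  revenue-single =
    solve 0 (con 0 :+ ((con 1 :+ con 0) :+ con 0 :+ con 0) := con 1) refl

  revenue≤1 : ∀ d → revenue d ≤ 1#
  revenue≤1 reject              = ≤-respˡ-≈ (sym revenue-reject) 0≤1
  revenue≤1 (assign zero)       = ≤-respˡ-≈ (sym revenue-pair) 0≤1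
  revenue≤1 (assign (suc zero)) = ≤-reflexive revenue-single

  𝔼Rev-first : ∀ (π : DecisionRule pairVersusSingle) →
               𝔼Rev pairVersusSingle π ≈ 𝔼 (π []) revenue
  𝔼Rev-first π = 𝔼-run-sure pairVersusSingle π p refl [] (Rev pairVersusSingle)

  sellSingle : OnlineAlgorithm pairVersusSingle
  sellSingle = record
    { rule         = λ { [] → (1# , assign (suc zero)) ∷ [] ; (_ ∷ _) → (1# , reject) ∷ [] }
    ; distribution = λ { [] → 0≤1 ∷ [] , 1*1+0≈1 ; (_ ∷ _) → 0≤1 ∷ [] , 1*1+0≈1 }
    ; admissible   = λ { [] → s≤s z≤n ∷ [] ; (_ ∷ _) → tt ∷ [] }
    }
    where
    1*1+0≈1 : 1# * 1# + 0# ≈ 1#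
    1*1+0≈1 = solve 0 (con 1 :* con 1 :+ con 0 := con 1) refl

  𝔼Rev-sellSingle : 𝔼Rev pairVersusSingle (OnlineAlgorithm.rule sellSingle) ≈ 1#
  𝔼Rev-sellSingle =
    trans (𝔼Rev-first (OnlineAlgorithm.rule sellSingle))
          (trans (+-identityʳ _) (trans (*-identityˡ _) revenue-single))

  -- No decision earns more than 1, hence no mixture of decisions does, and `sellSingle` attains 1.
  OPTon≈1 : IsOPTon pairVersusSingle 1#
  OPTon≈1 = upper , λ u bound → ≤-respˡ-≈ 𝔼Rev-sellSingle (bound sellSingle)
    where
    upper : ∀ (π : OnlineAlgorithm pairVersusSingle) →
            𝔼Rev pairVersusSingle (OnlineAlgorithm.rule π) ≤ 1#
    upper π = begin
      𝔼Rev pairVersusSingle rule  ≈⟨ 𝔼Rev-first rule ⟩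
      𝔼 (rule []) revenue         ≤⟨ 𝔼-mono-≤ (proj₁ (distribution [])) revenue≤1 ⟩
      𝔼 (rule []) (λ _ → 1#)      ≈⟨ proj₂ (distribution []) ⟩
      1#                          ∎
      where open OnlineAlgorithm π

  -- Optimal solutions of the LP.

  singleShare : LPVector pairVersusSingle → Carrier
  singleShare y = y (suc zero) zero

  -- The left side is `4v + 2s`. Since `v ≤ u`, it is at most `2(u + v + s)`, and the budget bounds
  -- the bracket by 1. The extra `s` measures the loss from spending budget on product 1.
  objective+singleShare≤2 : ∀ {y} → IsFeasible pairVersusSingle y →
                            objective pairVersusSingle y + singleShare y ≤ 2#
  objective+singleShare≤2 {y} feasible = begin
    objective pairVersusSingle y + s
      ≈⟨ solve 3 (λ u v s →
           (con 0 :+ con 0) :* u :+ ((con 0 :+ (con 1 :+ con 1) :* (con 1 :+ con 1)) :* v :+ con 0)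
             :+ ((con 1 :+ con 0) :* s :+ con 0 :+ con 0) :+ s
           := (con 1 :+ con 1) :* (v :+ (v :+ s))) refl u v s ⟩
    2# * (v + (v + s))
      ≤⟨ *-monoˡ-≤-nonneg 0≤1+1 (+-monoˡ-≤ (v + s) (decreasing zero zero (suc zero) ≡.refl)) ⟩
    2# * (u + (v + s))
      ≈⟨ *-congˡ (solve 3 (λ u v s →
           u :+ (v :+ s) := u :+ (v :+ con 0) :+ (s :+ con 0 :+ con 0)) refl u v s) ⟩
    2# * (u + (v + 0#) + (s + 0# + 0#))
      ≤⟨ *-monoˡ-≤-nonneg 0≤1+1 budget ⟩
    2# * (1# + 0#)
      ≈⟨ trans (*-congˡ (+-identityʳ 1#)) (*-identityʳ 2#) ⟩
    2# ∎
    where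
    open IsFeasible feasible
    u v s : Carrier
    u = y zero zero
    v = y zero (suc zero)
    s = singleShare y

  ½ : Carrier
  ½ = inverse 2# 1+1≉0

  2*½≈1 : 2# * ½ ≈ 1#
  2*½≈1 = proj₂ (proj₂ (≉0⇒invertible 1+1≉0))

  ½+½≈1 : ½ + ½ ≈ 1#
  ½+½≈1 = trans (solve 1 (λ x → x :+ x := (con 1 :+ con 1) :* x) refl ½) 2*½≈1

  -- If `½ ≤ 0#`, then `1# ≈ ½ + ½ ≤ ½`, so `½` is nonnegative in this case too.
  0≤½ : 0# ≤ ½
  0≤½ with total 0# ½
  ... | inj₁ 0≤½ = 0≤½
  ... | inj₂ ½≤0 = begin
    0#      ≤⟨ 0≤1 ⟩
    1#      ≈⟨ ½+½≈1 ⟨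
    ½ + ½   ≤⟨ +-monoʳ-≤ ½ ½≤0 ⟩
    ½ + 0#  ≈⟨ +-identityʳ ½ ⟩
    ½       ∎

  ½≤1 : ½ ≤ 1#
  ½≤1 = begin
    ½       ≈⟨ +-identityʳ ½ ⟨
    ½ + 0#  ≤⟨ +-monoʳ-≤ ½ 0≤½ ⟩
    ½ + ½   ≈⟨ ½+½≈1 ⟩
    1#      ∎

  -- Equal shares of both sales, a fully used budget and no share of product 1 make both estimates
  -- in `objective+singleShare≤2` tight.
  halfPair : LPVector pairVersusSingle
  halfPair zero       _ = ½
  halfPair (suc zero) _ = 0#

  halfPair-feasible : IsFeasible pairVersusSingle halfPair
  halfPair-feasible = record
    { budget     = ≤-reflexive (trans
        (solve 1 (λ x → x :+ (x :+ con 0) :+ (con 0 :+ con 0 :+ con 0)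
                        := x :+ x :+ con 0) refl ½)
        (+-congʳ ½+½≈1))
    ; decreasing = λ { zero _ _ _ → ≤-refl ; (suc zero) _ _ _ → ≤-refl }
    ; nonneg     = λ { zero _ → 0≤½ ; (suc zero) _ → ≤-refl }
    ; ≤1         = λ { zero _ → ½≤1 ; (suc zero) _ → 0≤1 }
    }

  objective-halfPair : objective pairVersusSingle halfPair ≈ 2#
  objective-halfPair = trans
    (solve 1 (λ x →
      (con 0 :+ con 0) :* x :+ ((con 0 :+ (con 1 :+ con 1) :* (con 1 :+ con 1)) :* x :+ con 0)
        :+ ((con 1 :+ con 0) :* con 0 :+ con 0 :+ con 0)
      := (con 1 :+ con 1) :* ((con 1 :+ con 1) :* x)) refl ½)
    (trans (*-congˡ 2*½≈1) (*-identityʳ 2#))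

  halfPair-optimal : IsOptimal pairVersusSingle halfPair
  halfPair-optimal = halfPair-feasible , λ z feasible → begin
    objective pairVersusSingle z                  ≈⟨ +-identityʳ _ ⟨
    objective pairVersusSingle z + 0#             ≤⟨ +-monoʳ-≤ _ (IsFeasible.nonneg feasible (suc zero) zero) ⟩
    objective pairVersusSingle z + singleShare z  ≤⟨ objective+singleShare≤2 feasible ⟩
    2#                                            ≈⟨ objective-halfPair ⟨
    objective pairVersusSingle halfPair           ∎

  -- An optimal value is at least the 2 of `halfPair`, so the bound of 2 on objective plus share
  -- leaves nothing for the share. As this covers every optimal solution, tie-breaking cannot help.
  optimal⇒singleShare≈0 : ∀ {y} → IsOptimal pairVersusSingle y → singleShare y ≈ 0#
  optimal⇒singleShare≈0 {y} (feasible , best) =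
    antisym (+-cancelˡ-≤ 2# (begin
      2# + singleShare y
        ≈⟨ +-congʳ objective-halfPair ⟨
      objective pairVersusSingle halfPair + singleShare y
        ≤⟨ +-monoˡ-≤ _ (best halfPair halfPair-feasible) ⟩
      objective pairVersusSingle y + singleShare y
        ≤⟨ objective+singleShare≤2 feasible ⟩
      2#
        ≈⟨ +-identityʳ 2# ⟨
      2# + 0# ∎))
    (IsFeasible.nonneg feasible (suc zero) zero)

  -- Revenue of the rounding algorithm.

  𝔼Rev-rounding≈0 : ∀ (μL≉0 : μL ≉ 0#) {y} → IsOptimal pairVersusSingle y →
                    𝔼Rev pairVersusSingle (rounding pairVersusSingle μL≉0 y) ≈ 0#
  𝔼Rev-rounding≈0 μL≉0 {y} optimal =
    trans (𝔼Rev-first (rounding pairVersusSingle μL≉0 y))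
          -- The summands come in the order of `direct`, and at the empty history `screen` changes
          -- none of them. Rejection and product 0 earn nothing whatever their weights; product 1
          -- has weight zero.
          (trans (+-cong (vanishesʳ revenue-reject)
                   (+-cong (vanishesʳ revenue-pair)
                     (+-congʳ (vanishesˡ q₁≈0))))
                 (solve 0 (con 0 :+ (con 0 :+ (con 0 :+ con 0)) := con 0) refl))
    where
    vanishesʳ : ∀ {w x} → x ≈ 0# → w * x ≈ 0#
    vanishesʳ {w} x≈0 = trans (*-congˡ x≈0) (zeroʳ w)
    vanishesˡ : ∀ {w x} → w ≈ 0# → w * x ≈ 0#
    vanishesˡ {x = x} w≈0 = trans (*-congʳ w≈0) (zeroˡ x)
    q₁≈0 : inverse μL μL≉0 * (singleShare y + 0#) ≈ 0#
    q₁≈0 = vanishesʳ (trans (+-identityʳ _) (optimal⇒singleShare≈0 optimal))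

  -- With optimum 1 and rounding revenue 0, the guarantee reads `α ≤ 0#`.
  no-guarantee : ∀ {α} → 0# < α → ¬ HasGuarantee α
  no-guarantee {α} (0≤α , 0≉α) guarantee
    with guarantee pairVersusSingle μL≉0 (halfPair , halfPair-optimal)
  ... | y , optimal , ratio = 0≉α (antisym 0≤α (begin
    α                                                        ≈⟨ *-identityʳ α ⟨
    α * 1#                                                   ≤⟨ ratio 1# OPTon≈1 ⟩
    𝔼Rev pairVersusSingle (rounding pairVersusSingle μL≉0 y)  ≈⟨ 𝔼Rev-rounding≈0 μL≉0 optimal ⟩
    0#                                                       ∎))

proposition2 : ∀ {c ℓ₁ ℓ₂} (F : OrderedField c ℓ₁ ℓ₂) →
    let open OrderedField F
        open Allocation F
    in ¬ (∃[ α ] (0# < α × HasGuarantee α))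
proposition2 F (α , 0<α , guarantee) = Counterexample.no-guarantee F 0<α guarantee
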